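{- Let $n,m$ be positive integers. A $\mathrm{QUH}(n,m)$ is equivalent to a pair of $n\times n$ amicable $(\pm1)$-matrices $A$ and $B$ satisfying $AA^T+mBB^T=(m+1)nI_n$. Explicitly: for $n\times n$ $(\pm1)$-matrices $A,B$, the matrix $$H=\frac{1}{\sqrt{m+1}}A+i\sqrt{\frac{m}{m+1}}\,B$$ is a $\mathrm{QUH}(n,m)$ if and only if $A$ and $B$ are amicable and $AA^T+mBB^T=(m+1)nI_n$; and every $\mathrm{QUH}(n,m)$ is of this form for some $n\times n$ $(\pm1)$-matrices $A,B$.
   Context: A unit Hadamard matrix of order $n$ is an $n\times n$ complex matrix $H$ all of whose entries have modulus $1$ and with $HH^*=nI_n$. For positive integers $n,m$, a $\mathrm{QUH}(n,m)$ (quaternary unit Hadamard matrix) is a unit Hadamard matrix of order $n$ all of whose entries lie in the four-element set $\left\{\epsilon\frac{1}{\sqrt{m+1}}+\delta\, i\sqrt{\frac{m}{m+1}} : \epsilon,\delta\in\{1,-1\}\right\}$. Two complex matrices $A,B$ are amicable if $AB^*=BA^*$ (for real matrices, $AB^T=BA^T$). A $(\pm1)$-matrix is a matrix with all entries in $\{1,-1\}$. -}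

module Defs where

open import Algebra.Bundles using (RawRing)
import Algebra.Definitions.RawMonoid as RawMonoidDefinitions
open import Data.Bool.Base using (if_then_else_)
open import Data.Empty using (⊥-elim)
open import Data.Fin.Base using (Fin)
import Data.Fin.Properties as Fin
import Data.Integer.Base as ℤ
import Data.Integer.Properties as ℤ
open import Data.Integer.Base using (+_)
open import Data.Nat.Base as ℕ using (ℕ; zero; suc)
import Data.Nat.Properties as ℕ
open import Data.Product.Base using (∃-syntax; _×_; _,_)
open import Data.Rational.Base
open import Data.Rational.Properties
open import Data.Rational.Solver using (module +-*-Solver)
import Data.Rational.Unnormalised.Base as ℚᵘ
import Data.Rational.Unnormalised.Properties as ℚᵘ
open import Data.Sum.Base using (_⊎_; inj₁; inj₂)
open import Level using (0ℓ)
open import Relation.Binary.PropositionalEquality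
open import Relation.Unary using (Decidable)
open import Relation.Nullary using (yes; no; ¬_; does)

-- The real numbers: Cauchy sequences of rationals, two sequences being
-- identified (`_≈ᴿ_`) when their difference tends to 0.

IsCauchy : (ℕ → ℚ) → Set
IsCauchy x = ∀ ε → 0ℚ < ε → ∃[ N ] (∀ i j → N ℕ.≤ i → N ℕ.≤ j → ∣ x i - x j ∣ < ε)

record ℝ : Set where
  constructor mkℝ
  field
    seq    : ℕ → ℚ
    cauchy : IsCauchy seq

open ℝ public

infix 4 _≈ᴿ_

_≈ᴿ_ : ℝ → ℝ → Set
x ≈ᴿ y = ∀ ε → 0ℚ < ε → ∃[ N ] (∀ i → N ℕ.≤ i → ∣ seq x i - seq y i ∣ < ε)

-- Apartness from 0, the constructive form of x ≢ 0.
_#0 : ℝ → Set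
x #0 = ∃[ ε ] (0ℚ < ε × ∃[ N ] (∀ i → N ℕ.≤ i → ε ≤ ∣ seq x i ∣))

-- 1 / q for q ≢ 0, and 0 for q ≡ 0; the second case affects only
-- finitely many terms of a sequence that is apart from 0.
recip : ℚ → ℚ
recip q with q ≟ 0ℚ
... | yes _   = 0ℚ
... | no  q≢0 = (1/ q) {{≢-nonZero q≢0}}

-- Opaque only to keep the type checker from normalising fractions.
opaque
  1/suc : ℕ → ℚ
  1/suc k = + 1 / suc k

  ℕ→ℚ : ℕ → ℚ
  ℕ→ℚ s = + s / 1

-- The largest s ≤ b satisfying P (and 0 if there is none).
largest : ∀ {P : ℕ → Set} → Decidable P → ℕ → ℕ
largest P? zero    = zero
largest P? (suc b) with P? (suc b)
... | yes _ = suc b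
... | no  _ = largest P? b

grid : ℕ → ℕ → ℚ
grid k s = ℕ→ℚ s * 1/suc k

√bound : ℕ → ℚ → ℕ
√bound k q = ℤ.∣ ↥ q ∣ ℕ.* suc k ℕ.+ suc k

-- √q (or 0 when q is negative) rounded down to a multiple of 1 / (k + 1).
-- The range searched is large enough because q ≤ |numerator of q|.
√approx : ℕ → ℚ → ℚ
√approx k q = grid k (largest (λ s → grid k s * grid k s ≤? q) (√bound k q))

private open module Solver = +-*-Solver using (solve; _:=_; _:+_; _:*_; _:-_; :-_)

abstract

  private
    half : ∀ {ε} → 0ℚ < ε → 0ℚ < ½ * ε
    half {ε} ε>0 = positive⁻¹ (½ * ε) {{pos*pos⇒pos ½ ε {{positive ε>0}}}}

    halves : ∀ ε → ½ * ε + ½ * ε ≡ ε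
    halves ε = trans (sym (*-distribʳ-+ ε ½ ½)) (*-identityˡ ε)

    0<* : ∀ {p q} → 0ℚ < p → 0ℚ < q → 0ℚ < p * q
    0<* {p} {q} p>0 q>0 = positive⁻¹ (p * q) {{pos*pos⇒pos p {{positive p>0}} q {{positive q>0}}}}

    0≤* : ∀ {p q} → 0ℚ ≤ p → 0ℚ ≤ q → 0ℚ ≤ p * q
    0≤* {p} {q} p≥0 q≥0 =
      nonNegative⁻¹ (p * q) {{nonNeg*nonNeg⇒nonNeg p {{nonNegative p≥0}} q {{nonNegative q≥0}}}}

    *-mono : ∀ {p q r s} → 0ℚ ≤ p → 0ℚ ≤ s → p ≤ q → r ≤ s → p * r ≤ q * s
    *-mono {p} {q} {r} {s} p≥0 s≥0 p≤q r≤s =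
      ≤-trans (*-monoˡ-≤-nonNeg p {{nonNegative p≥0}} r≤s) (*-monoʳ-≤-nonNeg s {{nonNegative s≥0}} p≤q)

    ∣*∣< : ∀ {p q P Q} → ∣ p ∣ < P → ∣ q ∣ < Q → ∣ p * q ∣ < P * Q
    ∣*∣< {p} {q} {P} {Q} p<P q<Q =
      subst (_< P * Q) (sym (∣p*q∣≡∣p∣*∣q∣ p q))
        (≤-<-trans (*-monoˡ-≤-nonNeg ∣ p ∣ {{∣-∣-nonNeg p}} (<⇒≤ q<Q))
                   (*-monoˡ-<-pos Q {{positive (≤-<-trans (0≤∣p∣ q) q<Q)}} p<P))

    ∣+∣< : ∀ {p q P Q} → ∣ p ∣ < P → ∣ q ∣ < Q → ∣ p + q ∣ < P + Q
    ∣+∣< {p} {q} p<P q<Q = ≤-<-trans (∣p+q∣≤∣p∣+∣q∣ p q) (+-mono-< p<P q<Q)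

    ∣-∣-comm : ∀ p q → ∣ p - q ∣ ≡ ∣ q - p ∣
    ∣-∣-comm p q = trans (sym (∣-p∣≡∣p∣ (p - q)))
      (cong ∣_∣ (solve 2 (λ p q → :- (p :- q) := q :- p) refl p q))

    p≤∣p∣ : ∀ p → p ≤ ∣ p ∣
    p≤∣p∣ p with ≤-total 0ℚ p
    ... | inj₁ 0≤p = ≤-reflexive (sym (0≤p⇒∣p∣≡p 0≤p))
    ... | inj₂ p≤0 = ≤-trans p≤0 (0≤∣p∣ p)

    ∣-∣<⇒< : ∀ {p q e} → ∣ p - q ∣ < e → p < q + e
    ∣-∣<⇒< {p} {q} {e} h =
      subst (_< q + e) (solve 2 (λ p q → q :+ (p :- q) := p) refl p q)
        (+-monoʳ-< q (≤-<-trans (p≤∣p∣ (p - q)) h))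

    <⇒∣-∣< : ∀ {p q e} → p < q + e → q < p + e → ∣ p - q ∣ < e
    <⇒∣-∣< {p} {q} {e} h₁ h₂ with ∣p∣≡p∨∣p∣≡-p (p - q)
    ... | inj₁ eq = subst₂ _<_ (sym eq) (solve 2 (λ q e → q :+ e :- q := e) refl q e)
                      (+-monoˡ-< (- q) h₁)
    ... | inj₂ eq = subst₂ _<_ (trans (solve 2 (λ p q → q :- p := :- (p :- q)) refl p q) (sym eq))
                      (solve 2 (λ p e → p :+ e :- p := e) refl p e)
                      (+-monoˡ-< (- p) h₂)

    quotient : ∀ {B ε} → 0ℚ < B → 0ℚ < ε → ∃[ δ ] (0ℚ < δ × B * δ ≡ ε)
    quotient {B} {ε} B>0 ε>0 =
      (1/ B) * ε , 0<* (positive⁻¹ (1/ B) {{1/pos⇒pos B}}) ε>0 ,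
      trans (sym (*-assoc B (1/ B) ε)) (trans (cong (_* ε) (*-inverseʳ B)) (*-identityˡ ε))
      where
      instance
        B⁺ : Positive B
        B⁺ = positive B>0
        B≢0 : NonZero B
        B≢0 = pos⇒nonZero B

    ⊔₁ : ∀ {M N i} → M ℕ.⊔ N ℕ.≤ i → M ℕ.≤ i
    ⊔₁ {M} {N} = ℕ.≤-trans (ℕ.m≤m⊔n M N)

    ⊔₂ : ∀ {M N i} → M ℕ.⊔ N ℕ.≤ i → N ℕ.≤ i
    ⊔₂ {M} {N} = ℕ.≤-trans (ℕ.m≤n⊔m M N)

opaque
  unfolding ℕ→ℚ 1/suc

  ℕ→ℚ-zero : ℕ→ℚ 0 ≡ 0ℚ
  ℕ→ℚ-zero = refl

  ℕ→ℚ-suc : ∀ s → ℕ→ℚ (suc s) ≡ ℕ→ℚ s + 1ℚ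
  ℕ→ℚ-suc s = toℚᵘ-injective (ℚᵘ.≃-trans (toℚᵘ-fromℚᵘ (ℚᵘ.mkℚᵘ (+ suc s) 0))
    (ℚᵘ.≃-trans (ℚᵘ.*≡* (cong (ℤ._* + 1) eq))
    (ℚᵘ.≃-sym (ℚᵘ.≃-trans (toℚᵘ-homo-+ (ℕ→ℚ s) 1ℚ)
      (ℚᵘ.+-cong (toℚᵘ-fromℚᵘ (ℚᵘ.mkℚᵘ (+ s) 0)) ℚᵘ.≃-refl)))))
    where
    eq : + suc s ≡ + s ℤ.* + 1 ℤ.+ + 1 ℤ.* + 1
    eq = sym (trans (cong (ℤ._+ + 1) (ℤ.*-identityʳ (+ s))) (cong +_ (ℕ.+-comm s 1)))

  ℕ→ℚ-* : ∀ s t → ℕ→ℚ (s ℕ.* t) ≡ ℕ→ℚ s * ℕ→ℚ t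
  ℕ→ℚ-* s t = toℚᵘ-injective (ℚᵘ.≃-trans (toℚᵘ-fromℚᵘ (ℚᵘ.mkℚᵘ (+ (s ℕ.* t)) 0))
    (ℚᵘ.≃-trans (ℚᵘ.*≡* (cong (ℤ._* + 1) (ℤ.pos-* s t)))
    (ℚᵘ.≃-sym (ℚᵘ.≃-trans (toℚᵘ-homo-* (ℕ→ℚ s) (ℕ→ℚ t))
      (ℚᵘ.*-cong (toℚᵘ-fromℚᵘ (ℚᵘ.mkℚᵘ (+ s) 0)) (toℚᵘ-fromℚᵘ (ℚᵘ.mkℚᵘ (+ t) 0)))))))

  ℕ→ℚ*1/suc : ∀ k → ℕ→ℚ (suc k) * 1/suc k ≡ 1ℚ
  ℕ→ℚ*1/suc k = toℚᵘ-injective (ℚᵘ.≃-trans (toℚᵘ-homo-* (ℕ→ℚ (suc k)) (1/suc k))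
    (ℚᵘ.≃-trans (ℚᵘ.*-cong (toℚᵘ-fromℚᵘ (ℚᵘ.mkℚᵘ (+ suc k) 0)) (toℚᵘ-fromℚᵘ (ℚᵘ.mkℚᵘ (+ 1) k)))
      (ℚᵘ.*≡* (trans (ℤ.*-identityʳ (+ suc k ℤ.* + 1))
        (trans (ℤ.*-identityʳ (+ suc k)) (sym (trans (ℤ.*-identityˡ _) (cong (λ d → + suc d) (ℕ.+-identityʳ k)))))))))

  ∣num∣-bound : ∀ q → q ≤ ℕ→ℚ ℤ.∣ ↥ q ∣
  ∣num∣-bound q@(mkℚ n d _) = toℚᵘ-cancel-≤
    (ℚᵘ.≤-trans (ℚᵘ.*≤* le) (ℚᵘ.≤-reflexive (ℚᵘ.≃-sym (toℚᵘ-fromℚᵘ (ℚᵘ.mkℚᵘ (+ ℤ.∣ n ∣) 0)))))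
    where
    le′ : ∀ n → n ℤ.≤ + ℤ.∣ n ∣
    le′ (+ _)        = ℤ.≤-refl
    le′ (ℤ.-[1+ _ ]) = ℤ.-≤+
    le : n ℤ.* + 1 ℤ.≤ + ℤ.∣ n ∣ ℤ.* + suc d
    le = ℤ.≤-trans (ℤ.≤-reflexive (ℤ.*-identityʳ n)) (ℤ.≤-trans (le′ n)
      (subst (+ ℤ.∣ n ∣ ℤ.≤_) (ℤ.pos-* ℤ.∣ n ∣ (suc d)) (ℤ.+≤+ (ℕ.m≤m*n ℤ.∣ n ∣ (suc d)))))

  ℕ→ℚ≥0 : ∀ s → 0ℚ ≤ ℕ→ℚ s
  ℕ→ℚ≥0 s = nonNegative⁻¹ (ℕ→ℚ s) {{normalize-nonNeg s 1}}

  1/suc>0 : ∀ k → 0ℚ < 1/suc k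
  1/suc>0 k = positive⁻¹ (1/suc k) {{normalize-pos 1 (suc k)}}

  1/suc→0 : ∀ ε → 0ℚ < ε → ∃[ N ] (∀ k → N ℕ.≤ k → 1/suc k ≤ ε)
  1/suc→0 ε@(mkℚ (+ zero) d _)      (*<* (ℤ.+<+ ()))
  1/suc→0 ε@(mkℚ (+ suc n) d _)     ε>0 = d , λ k d≤k → toℚᵘ-cancel-≤
    (ℚᵘ.≤-trans (ℚᵘ.≤-reflexive (toℚᵘ-fromℚᵘ (ℚᵘ.mkℚᵘ (+ 1) k)))
      (ℚᵘ.*≤* (subst₂ ℤ._≤_ (ℤ.pos-* 1 (suc d)) (ℤ.pos-* (suc n) (suc k))
        (ℤ.+≤+ (ℕ.*-mono-≤ {1} {suc n} (ℕ.s≤s ℕ.z≤n) (ℕ.s≤s d≤k))))))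
  1/suc→0 ε@(mkℚ (ℤ.-[1+ n ]) d _)  (*<* ())

  1/suc≤½ : ∀ k → 1 ℕ.≤ k → 1/suc k ≤ ½
  1/suc≤½ k 1≤k = toℚᵘ-cancel-≤ (ℚᵘ.≤-trans (ℚᵘ.≤-reflexive (toℚᵘ-fromℚᵘ (ℚᵘ.mkℚᵘ (+ 1) k)))
    (ℚᵘ.*≤* (subst₂ ℤ._≤_ (ℤ.pos-* 1 2) (ℤ.pos-* 1 (suc k))
      (ℤ.+≤+ (ℕ.*-monoʳ-≤ 1 (ℕ.s≤s 1≤k))))))

abstract

  largest-satisfies : ∀ {P : ℕ → Set} (P? : Decidable P) b →
                      largest P? b ≡ 0 ⊎ P (largest P? b)
  largest-satisfies P? zero    = inj₁ refl
  largest-satisfies P? (suc b) with P? (suc b)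
  ... | yes p = inj₂ p
  ... | no  _ = largest-satisfies P? b

  largest-maximal : ∀ {P : ℕ → Set} (P? : Decidable P) b →
                    ¬ P (suc b) → ¬ P (suc (largest P? b))
  largest-maximal P? zero    h = h
  largest-maximal P? (suc b) h with P? (suc b)
  ... | yes _ = h
  ... | no ¬p = largest-maximal P? b ¬p

  grid≥0 : ∀ k s → 0ℚ ≤ grid k s
  grid≥0 k s = 0≤* (ℕ→ℚ≥0 s) (<⇒≤ (1/suc>0 k))

  grid-suc : ∀ k s → grid k (suc s) ≡ grid k s + 1/suc k
  grid-suc k s = trans (cong (_* 1/suc k) (ℕ→ℚ-suc s))
    (trans (*-distribʳ-+ (1/suc k) (ℕ→ℚ s) 1ℚ) (cong (λ e → grid k s + e) (*-identityˡ (1/suc k))))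

  √approx≥0 : ∀ k q → 0ℚ ≤ √approx k q
  √approx≥0 k q = grid≥0 k _

  √approx-lower : ∀ k q → √approx k q ≡ 0ℚ ⊎ √approx k q * √approx k q ≤ q
  √approx-lower k q with largest-satisfies (λ s → grid k s * grid k s ≤? q) (√bound k q)
  ... | inj₁ eq = inj₁ (trans (cong (grid k) eq) (trans (cong (_* 1/suc k) ℕ→ℚ-zero) (*-zeroˡ (1/suc k))))
  ... | inj₂ le = inj₂ le

  grid-bound : ∀ k c → grid k (c ℕ.* suc k ℕ.+ suc k) ≡ ℕ→ℚ c + 1ℚ
  grid-bound k c = trans (cong (grid k) (ℕ.+-comm (c ℕ.* suc k) (suc k)))
    (trans (cong (_* 1/suc k) (ℕ→ℚ-* (suc c) (suc k)))
    (trans (*-assoc (ℕ→ℚ (suc c)) (ℕ→ℚ (suc k)) (1/suc k))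
    (trans (cong (ℕ→ℚ (suc c) *_) (ℕ→ℚ*1/suc k))
    (trans (*-identityʳ (ℕ→ℚ (suc c))) (ℕ→ℚ-suc c)))))

  private
    square-bound : ∀ {q a g} → q ≤ a → 0ℚ ≤ a → a + 1ℚ ≤ g → q < g * g
    square-bound {q} {a} {g} q≤a 0≤a a+1≤g = <-≤-trans (≤-<-trans q≤a
        (subst (_< a + 1ℚ) (+-identityʳ a) (+-monoʳ-< a (positive⁻¹ 1ℚ))))
      (≤-trans a+1≤g (subst (_≤ g * g) (*-identityˡ g)
        (*-mono (nonNegative⁻¹ 1ℚ) 0≤g 1≤g ≤-refl)))
      where
      1≤g : 1ℚ ≤ g
      1≤g = ≤-trans (subst (_≤ a + 1ℚ) (+-identityˡ 1ℚ) (+-monoˡ-≤ 1ℚ 0≤a)) a+1≤g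
      0≤g : 0ℚ ≤ g
      0≤g = ≤-trans (nonNegative⁻¹ 1ℚ) 1≤g

    p≤p+ : ∀ {p q} → 0ℚ ≤ q → p ≤ p + q
    p≤p+ {p} {q} q≥0 = subst (_≤ p + q) (+-identityʳ p) (+-monoʳ-≤ p q≥0)

  grid-bound-≤ : ∀ k c → ℕ→ℚ c + 1ℚ ≤ grid k (suc (c ℕ.* suc k ℕ.+ suc k))
  grid-bound-≤ k c = subst₂ _≤_ (grid-bound k c) (sym (grid-suc k (c ℕ.* suc k ℕ.+ suc k)))
    (p≤p+ (<⇒≤ (1/suc>0 k)))

  √bound-large : ∀ k q → ¬ (grid k (suc (√bound k q)) * grid k (suc (√bound k q)) ≤ q)
  √bound-large k q le = <-irrefl refl (<-≤-trans
    (square-bound (∣num∣-bound q) (ℕ→ℚ≥0 ℤ.∣ ↥ q ∣) (grid-bound-≤ k ℤ.∣ ↥ q ∣)) le)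

  √approx-upper : ∀ k q → let s = √approx k q + 1/suc k in q < s * s
  √approx-upper k q = subst (λ s → q < s * s)
    (grid-suc k (largest (λ s → grid k s * grid k s ≤? q) (√bound k q)))
    (≰⇒> (largest-maximal (λ s → grid k s * grid k s ≤? q) (√bound k q) (√bound-large k q)))

  private
    expand-sq : ∀ u h → u * u + h * h + (u * h + u * h) ≡ (u + h) * (u + h)
    expand-sq u h = solve 2 (λ u h → u :* u :+ h :* h :+ (u :* h :+ u :* h) := (u :+ h) :* (u :+ h)) refl u h

    square-≤ : ∀ {u h s} → 0ℚ ≤ u → 0ℚ ≤ h → u + h ≤ s → u * u + h * h ≤ s * s
    square-≤ {u} {h} {s} u≥0 h≥0 u+h≤s = ≤-trans
      (subst (u * u + h * h ≤_) (expand-sq u h)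
        (p≤p+ (≤-trans (0≤* u≥0 h≥0) (p≤p+ (0≤* u≥0 h≥0)))))
      (*-mono u+h≥0 (≤-trans u+h≥0 u+h≤s) u+h≤s u+h≤s)
      where
      u+h≥0 : 0ℚ ≤ u + h
      u+h≥0 = ≤-trans u≥0 (p≤p+ h≥0)

    √-close : ∀ {s t p q δ h} → 0ℚ ≤ t → 0ℚ ≤ δ → s ≡ 0ℚ ⊎ s * s ≤ p → q < (t + δ) * (t + δ) →
              0ℚ < h → δ ≤ h → ∣ p - q ∣ < h * h → ¬ (t + (h + h) ≤ s)
    √-close {s} {t} {p} {q} {δ} {h} t≥0 δ≥0 lower upper h>0 δ≤h close le =
      <-irrefl refl (≤-<-trans (s²≤p lower) (<-≤-trans p< (square-≤ u≥0 (<⇒≤ h>0) u+h≤s)))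
      where
      u : ℚ
      u = t + h
      u≥0 : 0ℚ ≤ u
      u≥0 = ≤-trans t≥0 (p≤p+ (<⇒≤ h>0))
      u+h≤s : u + h ≤ s
      u+h≤s = subst (_≤ s) (sym (+-assoc t h h)) le
      s>0 : 0ℚ < s
      s>0 = <-≤-trans h>0 (≤-trans (subst (_≤ u + h) (+-identityˡ h) (+-monoˡ-≤ h u≥0)) u+h≤s)
      s²≤p : s ≡ 0ℚ ⊎ s * s ≤ p → s * s ≤ p
      s²≤p (inj₁ eq) = ⊥-elim (<-irrefl (sym eq) s>0)
      s²≤p (inj₂ le) = le
      q≤u² : q ≤ u * u
      q≤u² = ≤-trans (<⇒≤ upper)
        (*-mono (≤-trans t≥0 (p≤p+ δ≥0)) u≥0 (+-monoʳ-≤ t δ≤h) (+-monoʳ-≤ t δ≤h))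
      p< : p < u * u + h * h
      p< = <-≤-trans (∣-∣<⇒< close) (+-monoˡ-≤ (h * h) q≤u²)

  √approx-< : ∀ k l p q {h} → 0ℚ < h → 1/suc l ≤ h → ∣ p - q ∣ < h * h →
              √approx k p < √approx l q + (h + h)
  √approx-< k l p q h>0 δ≤h close = ≰⇒>
    (√-close (√approx≥0 l q) (<⇒≤ (1/suc>0 l)) (√approx-lower k p) (√approx-upper l q) h>0 δ≤h close)

  bounded : ∀ x → IsCauchy x → ∃[ B ] (0ℚ < B × ∃[ N ] (∀ i → N ℕ.≤ i → ∣ x i ∣ < B))
  bounded x cx with cx 1ℚ (positive⁻¹ 1ℚ)
  ... | N , close =
    1ℚ + ∣ x N ∣ , <-≤-trans (positive⁻¹ 1ℚ) (subst (_≤ 1ℚ + ∣ x N ∣) (+-identityʳ 1ℚ)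
                     (+-monoʳ-≤ 1ℚ (0≤∣p∣ (x N)))) ,
    N , λ i N≤i → subst (λ y → ∣ y ∣ < 1ℚ + ∣ x N ∣)
      (solve 2 (λ a b → (a :- b) :+ b := a) refl (x i) (x N))
      (≤-<-trans (∣p+q∣≤∣p∣+∣q∣ (x i - x N) (x N)) (+-monoˡ-< ∣ x N ∣ (close i N N≤i ℕ.≤-refl)))

  const-cauchy : ∀ q → IsCauchy (λ _ → q)
  const-cauchy q ε ε>0 = 0 , λ _ _ _ _ → subst (λ y → ∣ y ∣ < ε) (sym (+-inverseʳ q)) ε>0

  +-cauchy : ∀ x y → IsCauchy x → IsCauchy y → IsCauchy (λ i → x i + y i)
  +-cauchy x y cx cy ε ε>0 with cx (½ * ε) (half ε>0) | cy (½ * ε) (half ε>0)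
  ... | M , hx | N , hy = M ℕ.⊔ N , λ i j i≥ j≥ →
    subst₂ (λ a b → ∣ a ∣ < b)
      (solve 4 (λ a b c d → (a :- b) :+ (c :- d) := (a :+ c) :- (b :+ d)) refl (x i) (x j) (y i) (y j))
      (halves ε)
      (∣+∣< (hx i j (⊔₁ {M} i≥) (⊔₁ {M} j≥)) (hy i j (⊔₂ {M} i≥) (⊔₂ {M} j≥)))

  neg-cauchy : ∀ x → IsCauchy x → IsCauchy (λ i → - x i)
  neg-cauchy x cx ε ε>0 with cx ε ε>0
  ... | N , hx = N , λ i j i≥ j≥ → subst (_< ε)
    (trans (∣-∣-comm (x i) (x j)) (cong ∣_∣ (solve 2 (λ a b → b :- a := :- a :- :- b) refl (x i) (x j))))
    (hx i j i≥ j≥)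

  private
    product-diff : ∀ a b c d → a * (c - d) + d * (a - b) ≡ a * c - b * d
    product-diff a b c d = begin
      a * (c - d) + d * (a - b)
        ≡⟨ cong₂ _+_ (*-distribˡ-+ a c (- d)) (*-distribˡ-+ d a (- b)) ⟩
      (a * c + a * - d) + (d * a + d * - b)
        ≡⟨ +-assoc (a * c) (a * - d) (d * a + d * - b) ⟩
      a * c + (a * - d + (d * a + d * - b))
        ≡⟨ cong (λ e → a * c + e) (sym (+-assoc (a * - d) (d * a) (d * - b))) ⟩
      a * c + ((a * - d + d * a) + d * - b)
        ≡⟨ cong (λ e → a * c + (e + d * - b)) cancel ⟩
      a * c + (0ℚ + d * - b)
        ≡⟨ cong (λ e → a * c + e) (trans (+-identityˡ (d * - b))
             (trans (sym (neg-distribʳ-* d b)) (cong -_ (*-comm d b)))) ⟩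
      a * c - b * d ∎
      where
      open ≡-Reasoning
      cancel : a * - d + d * a ≡ 0ℚ
      cancel = trans (cong₂ _+_ (sym (neg-distribʳ-* a d)) (*-comm d a)) (+-inverseˡ (a * d))

    *-close : ∀ a b c d {A B δ η ε} → ∣ a ∣ < A → ∣ d ∣ < B → ∣ c - d ∣ < δ → ∣ a - b ∣ < η →
              A * δ ≡ ½ * ε → B * η ≡ ½ * ε → ∣ a * c - b * d ∣ < ε
    *-close a b c d {A} {B} {δ} {η} {ε} ha hd hcd hab eq₁ eq₂ =
      subst (_< ε) (cong ∣_∣ (product-diff a b c d))
        (subst (∣ a * (c - d) + d * (a - b) ∣ <_) (trans (cong₂ _+_ eq₁ eq₂) (halves ε))
          (∣+∣< (∣*∣< ha hcd) (∣*∣< hd hab)))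

  *-cauchy : ∀ x y → IsCauchy x → IsCauchy y → IsCauchy (λ i → x i * y i)
  *-cauchy x y cx cy ε ε>0 =
    let A , A>0 , M , hA = bounded x cx
        B , B>0 , N , hB = bounded y cy
        δ , δ>0 , Aδ     = quotient A>0 (half ε>0)
        η , η>0 , Bη     = quotient B>0 (half ε>0)
        P , hy           = cy δ δ>0
        Q , hx           = cx η η>0
    in (M ℕ.⊔ N) ℕ.⊔ (P ℕ.⊔ Q) , λ i j i≥ j≥ →
      *-close (x i) (x j) (y i) (y j)
        (hA i (⊔₁ {M} (⊔₁ {M ℕ.⊔ N} i≥))) (hB j (⊔₂ {M} (⊔₁ {M ℕ.⊔ N} j≥)))
        (hy i j (⊔₁ {P} (⊔₂ {M ℕ.⊔ N} i≥)) (⊔₁ {P} (⊔₂ {M ℕ.⊔ N} j≥)))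
        (hx i j (⊔₂ {P} (⊔₂ {M ℕ.⊔ N} i≥)) (⊔₂ {P} (⊔₂ {M ℕ.⊔ N} j≥)))
        Aδ Bη

  recip-inverse : ∀ q → q ≢ 0ℚ → q * recip q ≡ 1ℚ
  recip-inverse q q≢0 with q ≟ 0ℚ
  ... | yes q≡0 = ⊥-elim (q≢0 q≡0)
  ... | no  q≢0 = *-inverseʳ q {{≢-nonZero q≢0}}

  recip-cauchy : ∀ x → x #0 → IsCauchy (λ i → recip (seq x i))
  recip-cauchy x (e , e>0 , M , away) ε ε>0 with cauchy x (ε * (e * e)) (0<* ε>0 (0<* e>0 e>0))
  ... | N , hx = M ℕ.⊔ N , λ i j i≥ j≥ →
    go (seq x i) (seq x j) (away i (⊔₁ {M} i≥)) (away j (⊔₁ {M} j≥))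
       (hx i j (⊔₂ {M} i≥) (⊔₂ {M} j≥))
    where
    ≢0 : ∀ {a} → e ≤ ∣ a ∣ → a ≢ 0ℚ
    ≢0 e≤ refl = <-irrefl refl (<-≤-trans e>0 e≤)
    go : ∀ a b → e ≤ ∣ a ∣ → e ≤ ∣ b ∣ → ∣ a - b ∣ < ε * (e * e) → ∣ recip a - recip b ∣ < ε
    go a b ea eb close = *-cancelʳ-<-nonNeg ∣ a * b ∣ {{∣-∣-nonNeg (a * b)}}
      (subst (_< ε * ∣ a * b ∣) eq (<-≤-trans close
        (*-monoˡ-≤-nonNeg ε {{nonNegative (<⇒≤ ε>0)}}
          (subst (e * e ≤_) (sym (∣p*q∣≡∣p∣*∣q∣ a b))
            (*-mono (<⇒≤ e>0) (0≤∣p∣ b) ea eb)))))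
      where
      eq : ∣ a - b ∣ ≡ ∣ recip a - recip b ∣ * ∣ a * b ∣
      eq = trans (∣-∣-comm a b) (trans (cong ∣_∣ (sym (trans
        (solve 4 (λ a b r s → (r :- s) :* (a :* b) := b :* (a :* r) :- a :* (b :* s)) refl a b (recip a) (recip b))
        (cong₂ _-_ (trans (cong (b *_) (recip-inverse a (≢0 ea))) (*-identityʳ b))
                   (trans (cong (a *_) (recip-inverse b (≢0 eb))) (*-identityʳ a))))))
        (∣p*q∣≡∣p∣*∣q∣ (recip a - recip b) (a * b)))

  √-cauchy : ∀ x → IsCauchy x → IsCauchy (λ k → √approx k (x k))
  √-cauchy x cx ε ε>0
    with cx (½ * ε * (½ * ε)) (0<* (half ε>0) (half ε>0)) | 1/suc→0 (½ * ε) (half ε>0)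
  ... | M , hx | N , small = M ℕ.⊔ N , λ i j i≥ j≥ →
    <⇒∣-∣< (subst (λ e → √approx i (x i) < √approx j (x j) + e) (halves ε)
              (√approx-< i j (x i) (x j) (half ε>0) (small j (⊔₂ {M} j≥)) (hx i j (⊔₁ {M} i≥) (⊔₁ {M} j≥))))
            (subst (λ e → √approx j (x j) < √approx i (x i) + e) (halves ε)
              (√approx-< j i (x j) (x i) (half ε>0) (small i (⊔₂ {M} i≥)) (hx j i (⊔₁ {M} j≥) (⊔₁ {M} i≥))))

  ½≤√approx-suc : ∀ m k → 1 ℕ.≤ k → ½ ≤ √approx k (ℕ→ℚ (suc m))
  ½≤√approx-suc m k 1≤k = ≮⇒≥ λ s<½ → <-irrefl refl
    (≤-<-trans 1≤m+1 (<-≤-trans (√approx-upper k (ℕ→ℚ (suc m))) (sq≤1 (<⇒≤ s<½))))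
    where
    s : ℚ
    s = √approx k (ℕ→ℚ (suc m))
    1≤m+1 : 1ℚ ≤ ℕ→ℚ (suc m)
    1≤m+1 = subst₂ _≤_ (+-identityˡ 1ℚ) (sym (ℕ→ℚ-suc m)) (+-monoˡ-≤ 1ℚ (ℕ→ℚ≥0 m))
    sq≤1 : s ≤ ½ → (s + 1/suc k) * (s + 1/suc k) ≤ 1ℚ
    sq≤1 s≤½ = *-mono {q = 1ℚ} {s = 1ℚ}
      (subst (_≤ s + 1/suc k) (+-identityˡ 0ℚ) (+-mono-≤ (√approx≥0 k (ℕ→ℚ (suc m))) (<⇒≤ (1/suc>0 k))))
      (nonNegative⁻¹ 1ℚ) (+-mono-≤ s≤½ (1/suc≤½ k 1≤k)) (+-mono-≤ s≤½ (1/suc≤½ k 1≤k))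

infixl 6 _+ᴿ_
infixl 7 _*ᴿ_
infix  8 -ᴿ_
infix  9 √_

fromℚ : ℚ → ℝ
fromℚ q = mkℝ (λ _ → q) (const-cauchy q)

fromℕ : ℕ → ℝ
fromℕ k = fromℚ (ℕ→ℚ k)

0ᴿ 1ᴿ : ℝ
0ᴿ = fromℚ 0ℚ
1ᴿ = fromℚ 1ℚ

_+ᴿ_ _*ᴿ_ : ℝ → ℝ → ℝ
x +ᴿ y = mkℝ (λ i → seq x i + seq y i) (+-cauchy (seq x) (seq y) (cauchy x) (cauchy y))
x *ᴿ y = mkℝ (λ i → seq x i * seq y i) (*-cauchy (seq x) (seq y) (cauchy x) (cauchy y))

-ᴿ_ : ℝ → ℝ
-ᴿ x = mkℝ (λ i → - seq x i) (neg-cauchy (seq x) (cauchy x))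

inverse : (x : ℝ) → x #0 → ℝ
inverse x x#0 = mkℝ (λ i → recip (seq x i)) (recip-cauchy x x#0)

-- The nonnegative square root; negative arguments are sent to 0.
√_ : ℝ → ℝ
√ x = mkℝ (λ k → √approx k (seq x k)) (√-cauchy (seq x) (cauchy x))

√suc#0 : ∀ m → (√ fromℕ (suc m)) #0
√suc#0 m = ½ , positive⁻¹ ½ , 1 , λ k 1≤k →
  ≤-trans (½≤√approx-suc m k 1≤k)
    (≤-reflexive (sym (0≤p⇒∣p∣≡p (√approx≥0 k (ℕ→ℚ (suc m))))))

ℝ-rawRing : RawRing 0ℓ 0ℓ
ℝ-rawRing = record
  { Carrier = ℝ ; _≈_ = _≈ᴿ_ ; _+_ = _+ᴿ_ ; _*_ = _*ᴿ_ ; -_ = -ᴿ_ ; 0# = 0ᴿ ; 1# = 1ᴿ }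

record ℂ : Set where
  constructor _+i_
  field
    re im : ℝ

open ℂ public

infix 4 _≈ᶜ_

_≈ᶜ_ : ℂ → ℂ → Set
z ≈ᶜ w = re z ≈ᴿ re w × im z ≈ᴿ im w

fromℝ : ℝ → ℂ
fromℝ x = x +i 0ᴿ

𝕚 : ℂ
𝕚 = 0ᴿ +i 1ᴿ

infixl 6 _+ᶜ_
infixl 7 _*ᶜ_

_+ᶜ_ _*ᶜ_ : ℂ → ℂ → ℂ
z +ᶜ w = (re z +ᴿ re w) +i (im z +ᴿ im w)
z *ᶜ w = (re z *ᴿ re w +ᴿ -ᴿ (im z *ᴿ im w)) +i (re z *ᴿ im w +ᴿ im z *ᴿ re w)

-ᶜ_ conj : ℂ → ℂ
-ᶜ z   = (-ᴿ re z) +i (-ᴿ im z)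
conj z = re z +i (-ᴿ im z)

modulus : ℂ → ℝ
modulus z = √ (re z *ᴿ re z +ᴿ im z *ᴿ im z)

ℂ-rawRing : RawRing 0ℓ 0ℓ
ℂ-rawRing = record
  { Carrier = ℂ ; _≈_ = _≈ᶜ_ ; _+_ = _+ᶜ_ ; _*_ = _*ᶜ_ ; -_ = -ᶜ_
  ; 0# = fromℝ 0ᴿ ; 1# = fromℝ 1ᴿ }

Matrix : ∀ {c} → Set c → ℕ → Set c
Matrix X n = Fin n → Fin n → X

infix 10 _ᵀ

_ᵀ : ∀ {c} {X : Set c} {n} → Matrix X n → Matrix X n
(A ᵀ) i j = A j i

module MatrixOperations {c ℓ} (R : RawRing c ℓ) where
  private module R = RawRing R
  open RawMonoidDefinitions R.+-rawMonoid using (sum)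

  infix  4 _≈_
  infixl 6 _⊕_
  infixl 7 _⊗_
  infixr 8 _∙_

  _≈_ : ∀ {n} → Matrix R.Carrier n → Matrix R.Carrier n → Set ℓ
  A ≈ B = ∀ i j → A i j R.≈ B i j

  _⊕_ _⊗_ : ∀ {n} → Matrix R.Carrier n → Matrix R.Carrier n → Matrix R.Carrier n
  (A ⊕ B) i j = A i j R.+ B i j
  (A ⊗ B) i j = sum (λ k → A i k R.* B k j)

  _∙_ : ∀ {n} → R.Carrier → Matrix R.Carrier n → Matrix R.Carrier n
  (a ∙ A) i j = a R.* A i j

  I : ∀ {n} → Matrix R.Carrier n
  I i j = if does (i Fin.≟ j) then R.1# else R.0#

module Mℝ = MatrixOperations ℝ-rawRing
module Mℂ = MatrixOperations ℂ-rawRing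

complexify : ∀ {n} → Matrix ℝ n → Matrix ℂ n
complexify A i j = fromℝ (A i j)

infix 10 _✶

_✶ : ∀ {n} → Matrix ℂ n → Matrix ℂ n
(H ✶) i j = conj (H j i)

IsSign : ℝ → Set
IsSign x = x ≈ᴿ 1ᴿ ⊎ x ≈ᴿ -ᴿ 1ᴿ

IsSignMatrix : ∀ {n} → Matrix ℝ n → Set
IsSignMatrix A = ∀ i j → IsSign (A i j)

Amicable : ∀ {n} → Matrix ℝ n → Matrix ℝ n → Set
Amicable A B = A Mℝ.⊗ B ᵀ Mℝ.≈ B Mℝ.⊗ A ᵀ

IsUnitHadamard : ∀ {n} → Matrix ℂ n → Set
IsUnitHadamard {n} H =
  (∀ i j → modulus (H i j) ≈ᴿ 1ᴿ) × H Mℂ.⊗ H ✶ Mℂ.≈ fromℝ (fromℕ n) Mℂ.∙ Mℂ.I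

1/√[1+_] : ℕ → ℝ
1/√[1+ m ] = inverse (√ fromℕ (suc m)) (√suc#0 m)

-- √(m / (m + 1))
√[_/1+] : ℕ → ℝ
√[ m /1+] = √ fromℚ (+ m / suc m)

IsQUH : ∀ n → ℕ → Matrix ℂ n → Set
IsQUH n m H = IsUnitHadamard H ×
  (∀ i j → ∃[ ε ] ∃[ δ ] (IsSign ε × IsSign δ ×
    H i j ≈ᶜ fromℝ ε *ᶜ fromℝ 1/√[1+ m ] +ᶜ fromℝ δ *ᶜ (𝕚 *ᶜ fromℝ √[ m /1+])))

-- (1/√(m+1)) A + i √(m/(m+1)) B
combine : ∀ {n} → ℕ → Matrix ℝ n → Matrix ℝ n → Matrix ℂ n
combine m A B =
  (fromℝ 1/√[1+ m ] Mℂ.∙ complexify A) Mℂ.⊕ ((𝕚 *ᶜ fromℝ √[ m /1+]) Mℂ.∙ complexify B)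

{-# OPTIONS --safe #-}

-- Write c = 1/√(m+1) and s = √(m/(m+1)), so that (m+1)c² = 1 and s² = mc². For
-- H = cA + isB the real part of HH* is c²(AAᵀ + mBBᵀ) and the imaginary part is
-- cs(BAᵀ - ABᵀ); as c² and cs are invertible, HH* = nI says exactly that
-- AAᵀ + mBBᵀ = (m+1)nI and that A and B are amicable. The entries of H have
-- modulus 1 because c² + s² = 1.
module Submission where

open import Defs
open import Data.Nat.Base using (ℕ; suc; _*_; NonZero)
open import Data.Product.Base using (_×_; ∃-syntax)
open import Function.Bundles using (_⇔_; mk⇔)

open import Algebra.Bundles using (CommutativeRing; RawRing)
import Algebra.Definitions.RawMonoid as RawMonoidDefinitions
import Algebra.Properties.Ring as RingProperties
import Algebra.Properties.Semiring.Sum as SemiringSum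
import Algebra.Solver.Ring.NaturalCoefficients.Default as NaturalCoefficients
open import Algebra.Structures using (IsCommutativeRing)
open import Data.Bool.Base using (true; false)
open import Data.Fin.Base using (Fin; zero; suc)
import Data.Fin.Properties as Fin
open import Data.Integer.Base as ℤ using (+_)
import Data.Integer.Properties as ℤ
import Data.Nat.Base as ℕ
import Data.Nat.Properties as ℕ
open import Data.Product.Base using (_,_; proj₁; proj₂)
open import Data.Rational.Base as Rat using (ℚ; 0ℚ; 1ℚ; ½; ∣_∣)
import Data.Rational.Properties as ℚ
open import Data.Rational.Solver using (module +-*-Solver)
import Data.Rational.Unnormalised.Base as ℚᵘ
import Data.Rational.Unnormalised.Properties as ℚᵘ
open import Data.Sum.Base using (inj₁; inj₂)
open import Level using (0ℓ)
open import Relation.Binary.PropositionalEquality as ≡ using (_≡_; _≢_)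
open import Relation.Nullary using (does)

-- Null sequences of rationals.

module _ where
  open Rat using (_+_; _-_; -_; _<_; _≤_) renaming (_*_ to _·_)
  open ≡ using (refl; sym; trans; cong; cong₂; subst; subst₂)
  open +-*-Solver using (solve; con; _:=_; _:+_; _:*_; _:-_; :-_)

  -- By definition `x ≈ᴿ y` is `Null` of the termwise difference, so equalities of reals reduce to
  -- closure properties of null sequences.
  Null : (ℕ → ℚ) → Set
  Null f = ∀ ε → 0ℚ < ε → ∃[ N ] (∀ i → N ℕ.≤ i → ∣ f i ∣ < ε)

  Bounded : (ℕ → ℚ) → Set
  Bounded f = ∃[ B ] (0ℚ < B × ∃[ N ] (∀ i → N ℕ.≤ i → ∣ f i ∣ < B))

  0<* : ∀ {p q} → 0ℚ < p → 0ℚ < q → 0ℚ < p · q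
  0<* {p} {q} p>0 q>0 =
    ℚ.positive⁻¹ (p · q) {{ℚ.pos*pos⇒pos p {{Rat.positive p>0}} q {{Rat.positive q>0}}}}

  half>0 : ∀ {ε} → 0ℚ < ε → 0ℚ < ½ · ε
  half>0 = 0<* (ℚ.positive⁻¹ ½)

  halves : ∀ ε → ½ · ε + ½ · ε ≡ ε
  halves ε = trans (sym (ℚ.*-distribʳ-+ ε ½ ½)) (ℚ.*-identityˡ ε)

  half<id : ∀ {ε} → 0ℚ < ε → ½ · ε < ε
  half<id {ε} ε>0 = subst₂ _<_ (ℚ.+-identityʳ (½ · ε)) (halves ε) (ℚ.+-monoʳ-< (½ · ε) (half>0 ε>0))

  0≤p² : ∀ p → 0ℚ ≤ p · p
  0≤p² p with ℚ.≤-total 0ℚ p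
  ... | inj₁ 0≤p = ℚ.nonNegative⁻¹ (p · p)
    {{ℚ.nonNeg*nonNeg⇒nonNeg p {{Rat.nonNegative 0≤p}} p {{Rat.nonNegative 0≤p}}}}
  ... | inj₂ p≤0 = ℚ.nonNegative⁻¹ (p · p)
    {{ℚ.nonPos*nonPos⇒nonPos p {{Rat.nonPositive p≤0}} p {{Rat.nonPositive p≤0}}}}

  Null-mono : ∀ {f g} → (∀ i → ∣ f i ∣ ≤ ∣ g i ∣) → Null g → Null f
  Null-mono f≤g g→0 ε ε>0 =
    let N , small = g→0 ε ε>0 in N , λ i N≤i → ℚ.≤-<-trans (f≤g i) (small i N≤i)

  Null-resp : ∀ {f g} → (∀ i → f i ≡ g i) → Null g → Null f
  Null-resp f≡g = Null-mono (λ i → ℚ.≤-reflexive (cong ∣_∣ (f≡g i)))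

  Null-+ : ∀ {f g} → Null f → Null g → Null (λ i → f i + g i)
  Null-+ {f} {g} f→0 g→0 ε ε>0 =
    let M , hf = f→0 (½ · ε) (half>0 ε>0)
        N , hg = g→0 (½ · ε) (half>0 ε>0)
    in M ℕ.⊔ N , λ i i≥ → ℚ.≤-<-trans (ℚ.∣p+q∣≤∣p∣+∣q∣ (f i) (g i))
         (subst (∣ f i ∣ + ∣ g i ∣ <_) (halves ε)
           (ℚ.+-mono-< (hf i (ℕ.≤-trans (ℕ.m≤m⊔n M N) i≥)) (hg i (ℕ.≤-trans (ℕ.m≤n⊔m M N) i≥))))

  Null-* : ∀ {f g} → Null f → Bounded g → Null (λ i → f i · g i)
  Null-* {f} {g} f→0 (B , B>0 , M , hg) ε ε>0 =
    -- The threshold ε/B is chosen so that multiplying by the bound B returns ε.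
    let N , hf = f→0 (ε · B⁻¹) (0<* ε>0 (ℚ.positive⁻¹ B⁻¹ {{ℚ.1/pos⇒pos B}}))
    in M ℕ.⊔ N , λ i i≥ →
      subst₂ _<_ (sym (ℚ.∣p*q∣≡∣p∣*∣q∣ (f i) (g i))) cancel
        (ℚ.≤-<-trans
          (ℚ.*-monoˡ-≤-nonNeg ∣ f i ∣ {{ℚ.∣-∣-nonNeg (f i)}}
            (ℚ.<⇒≤ (hg i (ℕ.≤-trans (ℕ.m≤m⊔n M N) i≥))))
          (ℚ.*-monoˡ-<-pos B (hf i (ℕ.≤-trans (ℕ.m≤n⊔m M N) i≥))))
    where
    instance
      B⁺ : Rat.Positive B
      B⁺ = Rat.positive B>0
      B≢0 : Rat.NonZero B
      B≢0 = ℚ.pos⇒nonZero B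
    B⁻¹ : ℚ
    B⁻¹ = Rat.1/ B
    cancel : ε · B⁻¹ · B ≡ ε
    cancel = trans (ℚ.*-assoc ε B⁻¹ B) (trans (cong (ε ·_) (ℚ.*-inverseˡ B)) (ℚ.*-identityʳ ε))

  1/suc-null : Null 1/suc
  1/suc-null ε ε>0 =
    -- `1/suc→0` gives only a weak inequality; starting from ε/2 makes the result strict.
    let N , small = 1/suc→0 (½ · ε) (half>0 ε>0)
    in N , λ k N≤k → ℚ.≤-<-trans
         (ℚ.≤-trans (ℚ.≤-reflexive (ℚ.0≤p⇒∣p∣≡p (ℚ.<⇒≤ (1/suc>0 k)))) (small k N≤k))
         (half<id ε>0)

  -- The reals as a commutative ring.

  -- The ring operations act termwise, so this transfers every ring identity of the rationals. The
  -- reals are explicit arguments because `_≈ᴿ_` sees them only through `seq`, which does not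
  -- determine their Cauchy proofs.
  pointwise : ∀ x y → (∀ i → seq x i ≡ seq y i) → x ≈ᴿ y
  pointwise x y eq ε ε>0 = 0 , λ i _ → subst (λ q → ∣ q ∣ < ε)
    (sym (trans (cong (_- seq y i) (eq i)) (ℚ.+-inverseʳ (seq y i)))) ε>0

  ≈ᴿ-sym : ∀ x y → x ≈ᴿ y → y ≈ᴿ x
  ≈ᴿ-sym x y = Null-mono λ i → ℚ.≤-reflexive (trans (sym (ℚ.∣-p∣≡∣p∣ (seq y i - seq x i)))
    (cong ∣_∣ (solve 2 (λ a b → :- (b :- a) := a :- b) refl (seq x i) (seq y i))))

  ≈ᴿ-trans : ∀ x y z → x ≈ᴿ y → y ≈ᴿ z → x ≈ᴿ z
  ≈ᴿ-trans x y z x≈y y≈z = Null-resp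
    (λ i → solve 3 (λ a b c → a :- c := (a :- b) :+ (b :- c)) refl (seq x i) (seq y i) (seq z i))
    (Null-+ x≈y y≈z)

  +ᴿ-cong : ∀ x y u v → x ≈ᴿ y → u ≈ᴿ v → x +ᴿ u ≈ᴿ y +ᴿ v
  +ᴿ-cong x y u v x≈y u≈v = Null-resp
    (λ i → solve 4 (λ a b c d → (a :+ c) :- (b :+ d) := (a :- b) :+ (c :- d)) refl
             (seq x i) (seq y i) (seq u i) (seq v i))
    (Null-+ x≈y u≈v)

  -ᴿ-cong : ∀ x y → x ≈ᴿ y → -ᴿ x ≈ᴿ -ᴿ y
  -ᴿ-cong x y x≈y = Null-resp
    (λ i → solve 2 (λ a b → :- a :- :- b := b :- a) refl (seq x i) (seq y i))
    (≈ᴿ-sym x y x≈y)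

  -- Since ac - bd = (a - b)c + (c - d)b and Cauchy sequences are bounded, the difference is a sum
  -- of two products of a null and a bounded sequence.
  *ᴿ-cong : ∀ x y u v → x ≈ᴿ y → u ≈ᴿ v → x *ᴿ u ≈ᴿ y *ᴿ v
  *ᴿ-cong x y u v x≈y u≈v = Null-resp
    (λ i → solve 4 (λ a b c d → (a :* c) :- (b :* d) := (a :- b) :* c :+ (c :- d) :* b) refl
             (seq x i) (seq y i) (seq u i) (seq v i))
    (Null-+ (Null-* x≈y (bounded (seq u) (cauchy u))) (Null-* u≈v (bounded (seq y) (cauchy y))))

  ℝ-isCommutativeRing : IsCommutativeRing _≈ᴿ_ _+ᴿ_ _*ᴿ_ -ᴿ_ 0ᴿ 1ᴿ
  ℝ-isCommutativeRing = record
    { isRing = record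
      { +-isAbelianGroup = record
        { isGroup = record
          { isMonoid = record
            { isSemigroup = record
              { isMagma = record
                { isEquivalence = record
                  { refl  = λ {x} → pointwise x x λ _ → refl
                  ; sym   = λ {x} {y} → ≈ᴿ-sym x y
                  ; trans = λ {x} {y} {z} → ≈ᴿ-trans x y z
                  }
                ; ∙-cong = λ {x} {y} {u} {v} → +ᴿ-cong x y u v
                }
              ; assoc = λ x y z → pointwise (x +ᴿ y +ᴿ z) (x +ᴿ (y +ᴿ z))
                  λ i → ℚ.+-assoc (seq x i) (seq y i) (seq z i)
              }
            ; identity = (λ x → pointwise (0ᴿ +ᴿ x) x λ i → ℚ.+-identityˡ (seq x i))
                       , (λ x → pointwise (x +ᴿ 0ᴿ) x λ i → ℚ.+-identityʳ (seq x i))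
            }
          ; inverse = (λ x → pointwise (-ᴿ x +ᴿ x) 0ᴿ λ i → ℚ.+-inverseˡ (seq x i))
                    , (λ x → pointwise (x +ᴿ -ᴿ x) 0ᴿ λ i → ℚ.+-inverseʳ (seq x i))
          ; ⁻¹-cong = λ {x} {y} → -ᴿ-cong x y
          }
        ; comm = λ x y → pointwise (x +ᴿ y) (y +ᴿ x) λ i → ℚ.+-comm (seq x i) (seq y i)
        }
      ; *-cong = λ {x} {y} {u} {v} → *ᴿ-cong x y u v
      ; *-assoc = λ x y z → pointwise (x *ᴿ y *ᴿ z) (x *ᴿ (y *ᴿ z))
          λ i → ℚ.*-assoc (seq x i) (seq y i) (seq z i)
      ; *-identity = (λ x → pointwise (1ᴿ *ᴿ x) x λ i → ℚ.*-identityˡ (seq x i))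
                   , (λ x → pointwise (x *ᴿ 1ᴿ) x λ i → ℚ.*-identityʳ (seq x i))
      ; distrib = (λ x y z → pointwise (x *ᴿ (y +ᴿ z)) (x *ᴿ y +ᴿ x *ᴿ z)
                    λ i → ℚ.*-distribˡ-+ (seq x i) (seq y i) (seq z i))
                , (λ x y z → pointwise ((y +ᴿ z) *ᴿ x) (y *ᴿ x +ᴿ z *ᴿ x)
                    λ i → ℚ.*-distribʳ-+ (seq x i) (seq y i) (seq z i))
      }
    ; *-comm = λ x y → pointwise (x *ᴿ y) (y *ᴿ x) λ i → ℚ.*-comm (seq x i) (seq y i)
    }

  ℝ-commutativeRing : CommutativeRing 0ℓ 0ℓ
  ℝ-commutativeRing = record { isCommutativeRing = ℝ-isCommutativeRing }

  -- Square roots, inverses and fractions.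

  -- Meant for q = s² and r = (s + d)², where s is a root of p rounded down with precision d: the
  -- error of s² is at most the gap between the two squares.
  ∣-∣-sandwich : ∀ {p q r} → q ≤ p → p ≤ r → ∣ q - p ∣ ≤ ∣ r - q ∣
  ∣-∣-sandwich {p} {q} {r} q≤p p≤r = subst₂ _≤_
    (sym (trans (trans (sym (ℚ.∣-p∣≡∣p∣ (q - p)))
      (cong ∣_∣ (solve 2 (λ p q → :- (q :- p) := p :- q) refl p q))) (ℚ.0≤p⇒∣p∣≡p 0≤p-q)))
    (sym (ℚ.0≤p⇒∣p∣≡p (ℚ.≤-trans 0≤p-q p-q≤r-q))) p-q≤r-q
    where
    p-q≤r-q : p - q ≤ r - q
    p-q≤r-q = ℚ.+-monoˡ-≤ (- q) p≤r
    0≤p-q : 0ℚ ≤ p - q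
    0≤p-q = subst (_≤ p - q) (ℚ.+-inverseʳ q) (ℚ.+-monoˡ-≤ (- q) q≤p)

  -- With s the k-th approximation and d = 1/(k + 1), the k-th term of x lies between s² and (s +
  -- d)². The gap d((s + d) + s) is null times bounded.
  √²≈ : ∀ x → (∀ i → 0ℚ ≤ seq x i) → √ x *ᴿ √ x ≈ᴿ x
  √²≈ x x≥0 = Null-mono
    (λ k → ∣-∣-sandwich (lower k) (ℚ.<⇒≤ (√approx-upper k (seq x k))))
    (Null-resp (λ k → solve 2 (λ s d → (s :+ d) :* (s :+ d) :- s :* s := d :* ((s :+ d) :+ s)) refl
                        (seq (√ x) k) (1/suc k))
      (Null-* 1/suc-null (bounded (seq (√ x +ᴿ δ +ᴿ √ x)) (cauchy (√ x +ᴿ δ +ᴿ √ x)))))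
    where
    lower : ∀ k → seq (√ x) k · seq (√ x) k ≤ seq x k
    lower k with √approx-lower k (seq x k)
    -- Here the search may have returned its default value 0, and nonnegativity of x supplies the
    -- bound.
    ... | inj₁ eq = subst (_≤ seq x k) (sym (trans (cong (_· seq (√ x) k) eq) (ℚ.*-zeroˡ (seq (√ x) k)))) (x≥0 k)
    ... | inj₂ le = le
    -- The precisions 1/(k + 1) are packaged as a real, so that the factor (s + d) + s is Cauchy and
    -- therefore bounded.
    δ : ℝ
    δ = mkℝ 1/suc λ ε ε>0 →
      let N , small = 1/suc-null (½ · ε) (half>0 ε>0)
      in N , λ i j i≥ j≥ → ℚ.≤-<-trans (ℚ.∣p-q∣≤∣p∣+∣q∣ (1/suc i) (1/suc j))
           (subst (∣ 1/suc i ∣ + ∣ 1/suc j ∣ <_) (halves ε) (ℚ.+-mono-< (small i i≥) (small j j≥)))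

  -- |s - 1| ≤ |s - 1| (s + 1) = |s² - 1| for s ≥ 0.
  √≈1 : ∀ x → (∀ i → 0ℚ ≤ seq x i) → x ≈ᴿ 1ᴿ → √ x ≈ᴿ 1ᴿ
  √≈1 x x≥0 x≈1 = Null-mono
    (λ k → ∣s-1∣≤∣s²-1∣ (seq (√ x) k) (√approx≥0 k (seq x k)))
    (≈ᴿ-trans (√ x *ᴿ √ x) x 1ᴿ (√²≈ x x≥0) x≈1)
    where
    ∣s-1∣≤∣s²-1∣ : ∀ s → 0ℚ ≤ s → ∣ s - 1ℚ ∣ ≤ ∣ s · s - 1ℚ ∣
    ∣s-1∣≤∣s²-1∣ s s≥0 = subst₂ _≤_ (ℚ.*-identityʳ ∣ s - 1ℚ ∣)
      (trans (cong (∣ s - 1ℚ ∣ ·_) (sym (ℚ.0≤p⇒∣p∣≡p (ℚ.≤-trans (ℚ.nonNegative⁻¹ 1ℚ) 1≤s+1))))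
        (trans (sym (ℚ.∣p*q∣≡∣p∣*∣q∣ (s - 1ℚ) (s + 1ℚ)))
          (cong ∣_∣ (solve 1 (λ s → (s :- con 1ℚ) :* (s :+ con 1ℚ)
                                       := s :* s :- con 1ℚ) refl s))))
      (ℚ.*-monoˡ-≤-nonNeg ∣ s - 1ℚ ∣ {{ℚ.∣-∣-nonNeg (s - 1ℚ)}} 1≤s+1)
      where
      1≤s+1 : 1ℚ ≤ s + 1ℚ
      1≤s+1 = subst (_≤ s + 1ℚ) (ℚ.+-identityˡ 1ℚ) (ℚ.+-monoˡ-≤ 1ℚ s≥0)

  -- Past the index N given by apartness the terms are nonzero and the products are exactly 1, so
  -- the same N serves every ε.
  *-inverseʳ : ∀ x (x#0 : x #0) → x *ᴿ inverse x x#0 ≈ᴿ 1ᴿ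
  *-inverseʳ x (e , e>0 , N , away) ε ε>0 = N , λ i N≤i → subst (λ q → ∣ q ∣ < ε)
    (sym (cong (_- 1ℚ) (recip-inverse (seq x i) (≢0 (away i N≤i))))) ε>0
    where
    ≢0 : ∀ {a} → e ≤ ∣ a ∣ → a ≢ 0ℚ
    ≢0 e≤ refl = ℚ.<-irrefl refl (ℚ.<-≤-trans e>0 e≤)

  opaque
    unfolding ℕ→ℚ

    -- Checked by cross-multiplication of unnormalised fractions, which avoids computing greatest
    -- common divisors.
    fraction-* : ∀ m → + m Rat./ suc m · ℕ→ℚ (suc m) ≡ ℕ→ℚ m
    fraction-* m = ℚ.toℚᵘ-injective (ℚᵘ.≃-trans (ℚ.toℚᵘ-homo-* (+ m Rat./ suc m) (ℕ→ℚ (suc m)))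
      (ℚᵘ.≃-trans (ℚᵘ.*-cong (ℚ.toℚᵘ-fromℚᵘ (ℚᵘ.mkℚᵘ (+ m) m)) (ℚ.toℚᵘ-fromℚᵘ (ℚᵘ.mkℚᵘ (+ suc m) 0)))
      (ℚᵘ.≃-trans
        (ℚᵘ.*≡* (trans (ℤ.*-identityʳ _) (cong (λ d → + m ℤ.* + suc d) (sym (ℕ.*-identityʳ m)))))
        (ℚᵘ.≃-sym (ℚ.toℚᵘ-fromℚᵘ (ℚᵘ.mkℚᵘ (+ m) 0))))))

  fraction≥0 : ∀ m → 0ℚ ≤ + m Rat./ suc m
  fraction≥0 m = ℚ.nonNegative⁻¹ (+ m Rat./ suc m) {{ℚ.normalize-nonNeg m (suc m)}}

  -- Complex arithmetic of the entries.

  -- Expands (ca + isb)(ca′ - isb′). The factors are given through their components up to `_≈ᴿ_`,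
  -- which is how the entries of `combine` are known.
  conj-product-re : ∀ c s a b a′ b′ z w →
    re z ≈ᴿ c *ᴿ a → im z ≈ᴿ s *ᴿ b → re w ≈ᴿ c *ᴿ a′ → im w ≈ᴿ s *ᴿ b′ →
    re (z *ᶜ conj w) ≈ᴿ c *ᴿ c *ᴿ (a *ᴿ a′) +ᴿ s *ᴿ s *ᴿ (b *ᴿ b′)
  conj-product-re c s a b a′ b′ z w p q p′ q′ = ≈ᴿ-trans (re (z *ᶜ conj w)) t
    (c *ᴿ c *ᴿ (a *ᴿ a′) +ᴿ s *ᴿ s *ᴿ (b *ᴿ b′))
    (+ᴿ-cong (re z *ᴿ re w) (c *ᴿ a *ᴿ (c *ᴿ a′)) (-ᴿ (im z *ᴿ -ᴿ im w)) (-ᴿ (s *ᴿ b *ᴿ -ᴿ (s *ᴿ b′)))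
      (*ᴿ-cong (re z) (c *ᴿ a) (re w) (c *ᴿ a′) p p′)
      (-ᴿ-cong (im z *ᴿ -ᴿ im w) (s *ᴿ b *ᴿ -ᴿ (s *ᴿ b′))
        (*ᴿ-cong (im z) (s *ᴿ b) (-ᴿ im w) (-ᴿ (s *ᴿ b′)) q (-ᴿ-cong (im w) (s *ᴿ b′) q′))))
    (pointwise t (c *ᴿ c *ᴿ (a *ᴿ a′) +ᴿ s *ᴿ s *ᴿ (b *ᴿ b′)) λ i →
      solve 6 (λ c s a b a′ b′ → c :* a :* (c :* a′) :+ :- (s :* b :* :- (s :* b′))
                 := c :* c :* (a :* a′) :+ s :* s :* (b :* b′)) refl
        (seq c i) (seq s i) (seq a i) (seq b i) (seq a′ i) (seq b′ i))
    where
    t : ℝ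
    t = c *ᴿ a *ᴿ (c *ᴿ a′) +ᴿ -ᴿ (s *ᴿ b *ᴿ -ᴿ (s *ᴿ b′))

  conj-product-im : ∀ c s a b a′ b′ z w →
    re z ≈ᴿ c *ᴿ a → im z ≈ᴿ s *ᴿ b → re w ≈ᴿ c *ᴿ a′ → im w ≈ᴿ s *ᴿ b′ →
    im (z *ᶜ conj w) ≈ᴿ c *ᴿ s *ᴿ (b *ᴿ a′) +ᴿ -ᴿ (c *ᴿ s) *ᴿ (a *ᴿ b′)
  conj-product-im c s a b a′ b′ z w p q p′ q′ = ≈ᴿ-trans (im (z *ᶜ conj w)) t
    (c *ᴿ s *ᴿ (b *ᴿ a′) +ᴿ -ᴿ (c *ᴿ s) *ᴿ (a *ᴿ b′))
    (+ᴿ-cong (re z *ᴿ -ᴿ im w) (c *ᴿ a *ᴿ -ᴿ (s *ᴿ b′)) (im z *ᴿ re w) (s *ᴿ b *ᴿ (c *ᴿ a′))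
      (*ᴿ-cong (re z) (c *ᴿ a) (-ᴿ im w) (-ᴿ (s *ᴿ b′)) p (-ᴿ-cong (im w) (s *ᴿ b′) q′))
      (*ᴿ-cong (im z) (s *ᴿ b) (re w) (c *ᴿ a′) q p′))
    (pointwise t (c *ᴿ s *ᴿ (b *ᴿ a′) +ᴿ -ᴿ (c *ᴿ s) *ᴿ (a *ᴿ b′)) λ i →
      solve 6 (λ c s a b a′ b′ → c :* a :* :- (s :* b′) :+ s :* b :* (c :* a′)
                 := c :* s :* (b :* a′) :+ :- (c :* s) :* (a :* b′)) refl
        (seq c i) (seq s i) (seq a i) (seq b i) (seq a′ i) (seq b′ i))
    where
    t : ℝ
    t = c *ᴿ a *ᴿ -ᴿ (s *ᴿ b′) +ᴿ s *ᴿ b *ᴿ (c *ᴿ a′)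

  -- For c = `1/√[1+ m ]` and s = `√[ m /1+]` this is definitionally an entry of `combine m A B`.
  entry : ℝ → ℝ → ℝ → ℝ → ℂ
  entry c s a b = fromℝ c *ᶜ fromℝ a +ᶜ 𝕚 *ᶜ fromℝ s *ᶜ fromℝ b

  entry-re : ∀ c s a b → re (entry c s a b) ≈ᴿ c *ᴿ a
  entry-re c s a b = pointwise (re (entry c s a b)) (c *ᴿ a) λ i →
    -- The constants are the zero imaginary parts of embedded reals and the components 0 and 1 of
    -- `𝕚`.
    solve 4 (λ c s a b → (c :* a :+ :- (con 0ℚ :* con 0ℚ))
                         :+ ((con 0ℚ :* s :+ :- (con 1ℚ :* con 0ℚ)) :* b
                             :+ :- ((con 0ℚ :* con 0ℚ :+ con 1ℚ :* s) :* con 0ℚ))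
                         := c :* a) refl (seq c i) (seq s i) (seq a i) (seq b i)

  entry-im : ∀ c s a b → im (entry c s a b) ≈ᴿ s *ᴿ b
  entry-im c s a b = pointwise (im (entry c s a b)) (s *ᴿ b) λ i →
    solve 4 (λ c s a b → (c :* con 0ℚ :+ con 0ℚ :* a)
                         :+ ((con 0ℚ :* s :+ :- (con 1ℚ :* con 0ℚ)) :* con 0ℚ
                             :+ (con 0ℚ :* con 0ℚ :+ con 1ℚ :* s) :* b)
                         := s :* b) refl (seq c i) (seq s i) (seq a i) (seq b i)

  *ᶜ-comm : ∀ z w → z *ᶜ w ≈ᶜ w *ᶜ z
  *ᶜ-comm z w =
    pointwise (re (z *ᶜ w)) (re (w *ᶜ z)) (λ i →
      cong₂ _-_ (ℚ.*-comm (seq (re z) i) (seq (re w) i)) (ℚ.*-comm (seq (im z) i) (seq (im w) i))) ,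
    pointwise (im (z *ᶜ w)) (im (w *ᶜ z)) (λ i →
      trans (ℚ.+-comm (seq (re z) i · seq (im w) i) (seq (im z) i · seq (re w) i))
        (cong₂ _+_ (ℚ.*-comm (seq (im z) i) (seq (re w) i)) (ℚ.*-comm (seq (re z) i) (seq (im w) i))))

  +ᶜ-cong : ∀ z w u v → z ≈ᶜ w → u ≈ᶜ v → z +ᶜ u ≈ᶜ w +ᶜ v
  +ᶜ-cong z w u v (p , q) (p′ , q′) =
    +ᴿ-cong (re z) (re w) (re u) (re v) p p′ , +ᴿ-cong (im z) (im w) (im u) (im v) q q′

  ≈ᶜ-trans : ∀ z w u → z ≈ᶜ w → w ≈ᶜ u → z ≈ᶜ u
  ≈ᶜ-trans z w u (p , q) (p′ , q′) =
    ≈ᴿ-trans (re z) (re w) (re u) p p′ , ≈ᴿ-trans (im z) (im w) (im u) q q′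

  ≈ᶜ-sym : ∀ z w → z ≈ᶜ w → w ≈ᶜ z
  ≈ᶜ-sym z w (p , q) = ≈ᴿ-sym (re z) (re w) p , ≈ᴿ-sym (im z) (im w) q

  -- Reconciles two orders of factors: `combine` puts the scalars first, `IsQUH` puts the signs
  -- first.
  entry-comm : ∀ c s a b → entry c s a b ≈ᶜ fromℝ a *ᶜ fromℝ c +ᶜ fromℝ b *ᶜ (𝕚 *ᶜ fromℝ s)
  entry-comm c s a b = +ᶜ-cong
    (fromℝ c *ᶜ fromℝ a) (fromℝ a *ᶜ fromℝ c) (𝕚 *ᶜ fromℝ s *ᶜ fromℝ b) (fromℝ b *ᶜ (𝕚 *ᶜ fromℝ s))
    (*ᶜ-comm (fromℝ c) (fromℝ a)) (*ᶜ-comm (𝕚 *ᶜ fromℝ s) (fromℝ b))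

  fromℝ-*-re : ∀ x y → re (fromℝ x *ᶜ fromℝ y) ≈ᴿ x *ᴿ y
  fromℝ-*-re x y = pointwise (re (fromℝ x *ᶜ fromℝ y)) (x *ᴿ y) λ i →
    solve 2 (λ x y → x :* y :+ :- (con 0ℚ :* con 0ℚ) := x :* y) refl (seq x i) (seq y i)

  fromℝ-*-im : ∀ x y → im (fromℝ x *ᶜ fromℝ y) ≈ᴿ 0ᴿ
  fromℝ-*-im x y = pointwise (im (fromℝ x *ᶜ fromℝ y)) 0ᴿ λ i →
    solve 2 (λ x y → x :* con 0ℚ :+ con 0ℚ :* y := con 0ℚ) refl (seq x i) (seq y i)

  -- Congruence suffices, because the constant products 1 · 1 and (-1)(-1) evaluate to 1.
  sign-square : ∀ x → IsSign x → x *ᴿ x ≈ᴿ 1ᴿ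
  sign-square x (inj₁ x≈1)  = *ᴿ-cong x 1ᴿ x 1ᴿ x≈1 x≈1
  sign-square x (inj₂ x≈-1) = *ᴿ-cong x (-ᴿ 1ᴿ) x (-ᴿ 1ᴿ) x≈-1 x≈-1

  modulus≈1 : ∀ z → re z *ᴿ re z +ᴿ im z *ᴿ im z ≈ᴿ 1ᴿ → modulus z ≈ᴿ 1ᴿ
  modulus≈1 z = √≈1 (re z *ᴿ re z +ᴿ im z *ᴿ im z) λ i →
    subst (_≤ seq (re z) i · seq (re z) i + seq (im z) i · seq (im z) i) (ℚ.+-identityˡ 0ℚ)
      (ℚ.+-mono-≤ (0≤p² (seq (re z) i)) (0≤p² (seq (im z) i)))

  fromℕ-suc : ∀ k → fromℕ (suc k) ≈ᴿ fromℕ k +ᴿ 1ᴿ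
  fromℕ-suc k = pointwise (fromℕ (suc k)) (fromℕ k +ᴿ 1ᴿ) λ _ → ℕ→ℚ-suc k

  fromℕ-* : ∀ k l → fromℕ (k * l) ≈ᴿ fromℕ k *ᴿ fromℕ l
  fromℕ-* k l = pointwise (fromℕ (k * l)) (fromℕ k *ᴿ fromℕ l) λ _ → ℕ→ℚ-* k l

  fromℕ-inverse : ∀ k → fromℕ (suc k) *ᴿ fromℚ (1/suc k) ≈ᴿ 1ᴿ
  fromℕ-inverse k = pointwise (fromℕ (suc k) *ᴿ fromℚ (1/suc k)) 1ᴿ λ _ → ℕ→ℚ*1/suc k

  -- The division-free form of s² = m/(m + 1), as `s²≈mc²` takes it.
  √-fraction² : ∀ m → √[ m /1+] *ᴿ √[ m /1+] *ᴿ fromℕ (suc m) ≈ᴿ fromℕ m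
  √-fraction² m = ≈ᴿ-trans (s *ᴿ s *ᴿ fromℕ (suc m)) (fromℚ q *ᴿ fromℕ (suc m)) (fromℕ m)
    (*ᴿ-cong (s *ᴿ s) (fromℚ q) (fromℕ (suc m)) (fromℕ (suc m)) (√²≈ (fromℚ q) λ _ → fraction≥0 m)
      (pointwise (fromℕ (suc m)) (fromℕ (suc m)) λ _ → refl))
    (pointwise (fromℚ q *ᴿ fromℕ (suc m)) (fromℕ m) λ _ → fraction-* m)
    where
    q : ℚ
    q = + m Rat./ suc m
    s : ℝ
    s = √[ m /1+]

-- Components of complex sums and scalar matrices.

open RawMonoidDefinitions (RawRing.+-rawMonoid ℝ-rawRing) using () renaming (sum to sumᴿ)
open RawMonoidDefinitions (RawRing.+-rawMonoid ℂ-rawRing) using () renaming (sum to sumᶜ)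

re-sum : ∀ {n} (f : Fin n → ℂ) → re (sumᶜ f) ≡ sumᴿ (λ k → re (f k))
re-sum {ℕ.zero}  f = ≡.refl
re-sum {ℕ.suc n} f = ≡.cong (re (f zero) +ᴿ_) (re-sum (λ k → f (suc k)))

im-sum : ∀ {n} (f : Fin n → ℂ) → im (sumᶜ f) ≡ sumᴿ (λ k → im (f k))
im-sum {ℕ.zero}  f = ≡.refl
im-sum {ℕ.suc n} f = ≡.cong (im (f zero) +ᴿ_) (im-sum (λ k → f (suc k)))

scalar-re : ∀ {n} x (i j : Fin n) → re ((fromℝ x Mℂ.∙ Mℂ.I) i j) ≈ᴿ x *ᴿ Mℝ.I i j
-- One case split evaluates the complex and the real identity matrix together.
scalar-re x i j with does (i Fin.≟ j)
... | true  = fromℝ-*-re x 1ᴿ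
... | false = fromℝ-*-re x 0ᴿ

scalar-im : ∀ {n} x (i j : Fin n) → im ((fromℝ x Mℂ.∙ Mℂ.I) i j) ≈ᴿ 0ᴿ
scalar-im x i j with does (i Fin.≟ j)
... | true  = fromℝ-*-im x 1ᴿ
... | false = fromℝ-*-im x 0ᴿ

-- Coefficient identities in an arbitrary commutative ring.

module _ {a ℓ} (R : CommutativeRing a ℓ) where
  open CommutativeRing R renaming (_*_ to _·_)
  open RingProperties ring using (-‿distribˡ-*; -‿distribʳ-*; x∙y⁻¹≈ε⇒x≈y)
  open SemiringSum semiring using (sum; sum-cong-≋; ∑-distrib-+; *-distribˡ-sum)
  open NaturalCoefficients commutativeSemiring using (solve; _:=_; _:+_; _:*_; con)
  open import Relation.Binary.Reasoning.Setoid setoid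

  sum-linear : ∀ {n} p q (t u v : Fin n → Carrier) → (∀ k → t k ≈ p · u k + q · v k) →
               sum t ≈ p · sum u + q · sum v
  sum-linear p q t u v eq = begin
    sum t                                          ≈⟨ sum-cong-≋ eq ⟩
    sum (λ k → p · u k + q · v k)                  ≈⟨ ∑-distrib-+ (λ k → p · u k) (λ k → q · v k) ⟩
    sum (λ k → p · u k) + sum (λ k → q · v k)      ≈⟨ +-cong (*-distribˡ-sum p u) (*-distribˡ-sum q v) ⟨
    p · sum u + q · sum v                          ∎

  -- Only these relations between 1/√(m+1) and √(m/(m+1)) enter. The inverse of m makes s, and with
  -- it cs, invertible.
  module Coefficients (c s m m⁻¹ m+1 : Carrier)
                      (m+1≈ : m+1 ≈ m + 1#) (mm⁻¹≈1 : m · m⁻¹ ≈ 1#)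
                      (c²[m+1]≈1 : c · c · m+1 ≈ 1#) (s²≈mc² : s · s ≈ m · (c · c)) where

    c²+s²≈1 : c · c + s · s ≈ 1#
    c²+s²≈1 = begin
      c · c + s · s           ≈⟨ +-congˡ s²≈mc² ⟩
      c · c + m · (c · c)     ≈⟨ solve 2 (λ c m → c :* c :+ m :* (c :* c) := c :* c :* (m :+ con 1)) refl c m ⟩
      c · c · (m + 1#)        ≈⟨ *-congˡ m+1≈ ⟨
      c · c · m+1             ≈⟨ c²[m+1]≈1 ⟩
      1#                      ∎

    unit-modulus : ∀ x y a b → x ≈ c · a → y ≈ s · b → a · a ≈ 1# → b · b ≈ 1# → x · x + y · y ≈ 1#
    unit-modulus x y a b x≈ y≈ a²≈1 b²≈1 = begin
      x · x + y · y                          ≈⟨ +-cong (*-cong x≈ x≈) (*-cong y≈ y≈) ⟩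
      c · a · (c · a) + s · b · (s · b)      ≈⟨ solve 4 (λ c a s b → c :* a :* (c :* a) :+ s :* b :* (s :* b)
                                                  := c :* c :* (a :* a) :+ s :* s :* (b :* b)) refl c a s b ⟩
      c · c · (a · a) + s · s · (b · b)      ≈⟨ +-cong (*-congˡ a²≈1) (*-congˡ b²≈1) ⟩
      c · c · 1# + s · s · 1#                ≈⟨ +-cong (*-identityʳ _) (*-identityʳ _) ⟩
      c · c + s · s                          ≈⟨ c²+s²≈1 ⟩
      1#                                     ∎

    private
      real-part : ∀ P Q → c · c · P + s · s · Q ≈ c · c · (P + m · Q)
      real-part P Q = begin
        c · c · P + s · s · Q              ≈⟨ +-congˡ (*-congʳ s²≈mc²) ⟩
        c · c · P + m · (c · c) · Q        ≈⟨ solve 4 (λ c m P Q → c :* c :* P :+ m :* (c :* c) :* Q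
                                                := c :* c :* (P :+ m :* Q)) refl c m P Q ⟩
        c · c · (P + m · Q)                ∎

      -- As (cs)² = mc⁴ = m/(m+1)², the inverse of cs is cs · (m+1)²/m.
      cs⁻¹ : Carrier
      cs⁻¹ = c · s · (m+1 · m+1) · m⁻¹

      cs⁻¹-inverse : cs⁻¹ · (c · s) ≈ 1#
      cs⁻¹-inverse = begin
        c · s · (m+1 · m+1) · m⁻¹ · (c · s)
          ≈⟨ solve 4 (λ c s N n → c :* s :* (N :* N) :* n :* (c :* s)
                        := c :* c :* (s :* s) :* (N :* N) :* n) refl c s m+1 m⁻¹ ⟩
        c · c · (s · s) · (m+1 · m+1) · m⁻¹
          ≈⟨ *-congʳ (*-congʳ (*-congˡ s²≈mc²)) ⟩
        c · c · (m · (c · c)) · (m+1 · m+1) · m⁻¹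
          ≈⟨ solve 4 (λ c m N n → c :* c :* (m :* (c :* c)) :* (N :* N) :* n
                        := c :* c :* N :* (c :* c :* N) :* (m :* n)) refl c m m+1 m⁻¹ ⟩
        c · c · m+1 · (c · c · m+1) · (m · m⁻¹)
          ≈⟨ *-cong (*-cong c²[m+1]≈1 c²[m+1]≈1) mm⁻¹≈1 ⟩
        1# · 1# · 1#
          ≈⟨ trans (*-identityʳ _) (*-identityʳ _) ⟩
        1# ∎

    -- The left side of the hypothesis is c²(P + mQ), and multiplying by m+1 cancels c². P, Q and J
    -- stand for entries of AAᵀ, BBᵀ and I.
    real-part⇒ : ∀ P Q n n′ J → n′ ≈ m+1 · n → c · c · P + s · s · Q ≈ n · J → P + m · Q ≈ n′ · J
    real-part⇒ P Q n n′ J n′≈ eq = begin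
      P + m · Q                        ≈⟨ *-identityˡ _ ⟨
      1# · (P + m · Q)                 ≈⟨ *-congʳ c²[m+1]≈1 ⟨
      c · c · m+1 · (P + m · Q)        ≈⟨ solve 3 (λ c N x → c :* c :* N :* x := N :* (c :* c :* x)) refl c m+1 (P + m · Q) ⟩
      m+1 · (c · c · (P + m · Q))      ≈⟨ *-congˡ (real-part P Q) ⟨
      m+1 · (c · c · P + s · s · Q)    ≈⟨ *-congˡ eq ⟩
      m+1 · (n · J)                    ≈⟨ *-assoc m+1 n J ⟨
      m+1 · n · J                      ≈⟨ *-congʳ n′≈ ⟨
      n′ · J                           ∎

    real-part⇐ : ∀ P Q n n′ J → n′ ≈ m+1 · n → P + m · Q ≈ n′ · J → c · c · P + s · s · Q ≈ n · J
    real-part⇐ P Q n n′ J n′≈ eq = begin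
      c · c · P + s · s · Q            ≈⟨ real-part P Q ⟩
      c · c · (P + m · Q)              ≈⟨ *-congˡ eq ⟩
      c · c · (n′ · J)                 ≈⟨ *-congˡ (*-congʳ n′≈) ⟩
      c · c · (m+1 · n · J)            ≈⟨ solve 4 (λ c N n J → c :* c :* (N :* n :* J) := c :* c :* N :* (n :* J)) refl c m+1 n J ⟩
      c · c · m+1 · (n · J)            ≈⟨ *-congʳ c²[m+1]≈1 ⟩
      1# · (n · J)                     ≈⟨ *-identityˡ _ ⟩
      n · J                            ∎

    -- The hypothesis says cs(Y - X) = 0, and cs is invertible. The sign sits on the coefficient to
    -- match the output of `sum-linear`.
    imaginary-part⇒ : ∀ X Y → c · s · Y + - (c · s) · X ≈ 0# → X ≈ Y
    imaginary-part⇒ X Y eq = sym (x∙y⁻¹≈ε⇒x≈y Y X (begin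
      Y + - X                               ≈⟨ *-identityˡ _ ⟨
      1# · (Y + - X)                        ≈⟨ *-congʳ cs⁻¹-inverse ⟨
      cs⁻¹ · (c · s) · (Y + - X)            ≈⟨ *-assoc cs⁻¹ (c · s) (Y + - X) ⟩
      cs⁻¹ · (c · s · (Y + - X))            ≈⟨ *-congˡ (distribˡ (c · s) Y (- X)) ⟩
      cs⁻¹ · (c · s · Y + c · s · - X)      ≈⟨ *-congˡ (+-congˡ (trans (sym (-‿distribʳ-* _ _)) (-‿distribˡ-* _ _))) ⟩
      cs⁻¹ · (c · s · Y + - (c · s) · X)    ≈⟨ *-congˡ eq ⟩
      cs⁻¹ · 0#                             ≈⟨ zeroʳ _ ⟩
      0#                                    ∎))

    imaginary-part⇐ : ∀ X Y → X ≈ Y → c · s · Y + - (c · s) · X ≈ 0#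
    imaginary-part⇐ X Y X≈Y = begin
      c · s · Y + - (c · s) · X      ≈⟨ +-congˡ (*-congˡ X≈Y) ⟩
      c · s · Y + - (c · s) · Y      ≈⟨ distribʳ Y (c · s) (- (c · s)) ⟨
      (c · s + - (c · s)) · Y        ≈⟨ *-congʳ (-‿inverseʳ (c · s)) ⟩
      0# · Y                         ≈⟨ zeroˡ Y ⟩
      0#                             ∎

  c²N≈1 : ∀ {r c N} → r · r ≈ N → r · c ≈ 1# → c · c · N ≈ 1#
  c²N≈1 {r} {c} {N} r²≈N rc≈1 = begin
    c · c · N            ≈⟨ *-congˡ r²≈N ⟨
    c · c · (r · r)      ≈⟨ solve 2 (λ c r → c :* c :* (r :* r) := r :* c :* (r :* c)) refl c r ⟩
    r · c · (r · c)      ≈⟨ *-cong rc≈1 rc≈1 ⟩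
    1# · 1#              ≈⟨ *-identityˡ 1# ⟩
    1#                   ∎

  s²≈mc² : ∀ {c s m N} → c · c · N ≈ 1# → s · s · N ≈ m → s · s ≈ m · (c · c)
  s²≈mc² {c} {s} {m} {N} c²N≈1 s²N≈m = begin
    s · s                  ≈⟨ *-identityʳ _ ⟨
    s · s · 1#             ≈⟨ *-congˡ c²N≈1 ⟨
    s · s · (c · c · N)    ≈⟨ solve 3 (λ s c N → s :* s :* (c :* c :* N) := s :* s :* N :* (c :* c)) refl s c N ⟩
    s · s · N · (c · c)    ≈⟨ *-congʳ s²N≈m ⟩
    m · (c · c)            ∎

-- The Gram matrix of H and the equivalence.

module _ (n k : ℕ) where
  private
    m : ℕ
    m = suc k
    c s r : ℝ
    c = 1/√[1+ m ]
    s = √[ m /1+]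
    r = √ fromℕ (suc m)

    c²[m+1]≈1 : c *ᴿ c *ᴿ fromℕ (suc m) ≈ᴿ 1ᴿ
    c²[m+1]≈1 = c²N≈1 ℝ-commutativeRing {r} {c} {fromℕ (suc m)}
      (√²≈ (fromℕ (suc m)) λ _ → ℕ→ℚ≥0 (suc m)) (*-inverseʳ r (√suc#0 m))

  -- Since m = k + 1, its inverse is `1/suc k`, with index k rather than m.
  open Coefficients ℝ-commutativeRing c s (fromℕ m) (fromℚ (1/suc k)) (fromℕ (suc m))
    (fromℕ-suc m) (fromℕ-inverse k) c²[m+1]≈1
    (s²≈mc² ℝ-commutativeRing {c} {s} {fromℕ m} {fromℕ (suc m)} c²[m+1]≈1 (√-fraction² m))

  module _ (A B : Matrix ℝ n) where
    private
      H : Matrix ℂ n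
      H = combine m A B

    gram-re : ∀ i j → re ((H Mℂ.⊗ H ✶) i j) ≈ᴿ
              c *ᴿ c *ᴿ (A Mℝ.⊗ A ᵀ) i j +ᴿ s *ᴿ s *ᴿ (B Mℝ.⊗ B ᵀ) i j
    gram-re i j = ≡.subst (_≈ᴿ c *ᴿ c *ᴿ (A Mℝ.⊗ A ᵀ) i j +ᴿ s *ᴿ s *ᴿ (B Mℝ.⊗ B ᵀ) i j)
      (≡.sym (re-sum (λ l → H i l *ᶜ conj (H j l))))
      (sum-linear ℝ-commutativeRing (c *ᴿ c) (s *ᴿ s)
        (λ l → re (H i l *ᶜ conj (H j l))) (λ l → A i l *ᴿ A j l) (λ l → B i l *ᴿ B j l)
        λ l → conj-product-re c s (A i l) (B i l) (A j l) (B j l) (H i l) (H j l)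
          (entry-re c s (A i l) (B i l)) (entry-im c s (A i l) (B i l))
          (entry-re c s (A j l) (B j l)) (entry-im c s (A j l) (B j l)))

    -- Conjugation negates only the second factor's imaginary part, so BAᵀ appears with a plus sign
    -- and ABᵀ with a minus sign.
    gram-im : ∀ i j → im ((H Mℂ.⊗ H ✶) i j) ≈ᴿ
              c *ᴿ s *ᴿ (B Mℝ.⊗ A ᵀ) i j +ᴿ -ᴿ (c *ᴿ s) *ᴿ (A Mℝ.⊗ B ᵀ) i j
    gram-im i j = ≡.subst (_≈ᴿ c *ᴿ s *ᴿ (B Mℝ.⊗ A ᵀ) i j +ᴿ -ᴿ (c *ᴿ s) *ᴿ (A Mℝ.⊗ B ᵀ) i j)
      (≡.sym (im-sum (λ l → H i l *ᶜ conj (H j l))))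
      (sum-linear ℝ-commutativeRing (c *ᴿ s) (-ᴿ (c *ᴿ s))
        (λ l → im (H i l *ᶜ conj (H j l))) (λ l → B i l *ᴿ A j l) (λ l → A i l *ᴿ B j l)
        λ l → conj-product-im c s (A i l) (B i l) (A j l) (B j l) (H i l) (H j l)
          (entry-re c s (A i l) (B i l)) (entry-im c s (A i l) (B i l))
          (entry-re c s (A j l) (B j l)) (entry-im c s (A j l) (B j l)))

    GramEquation : Set
    GramEquation = (A Mℝ.⊗ A ᵀ) Mℝ.⊕ (fromℕ m Mℝ.∙ (B Mℝ.⊗ B ᵀ)) Mℝ.≈ (fromℕ (suc m * n) Mℝ.∙ Mℝ.I)

    isQUH⇒ : IsQUH n m H → Amicable A B × GramEquation
    isQUH⇒ ((_ , HH✶≈nI) , _) = amicable , gram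
      where
      amicable : Amicable A B
      amicable i j = imaginary-part⇒ ((A Mℝ.⊗ B ᵀ) i j) ((B Mℝ.⊗ A ᵀ) i j)
        (≈ᴿ-trans imag z 0ᴿ (≈ᴿ-sym z imag (gram-im i j))
          (≈ᴿ-trans z (im ((fromℝ (fromℕ n) Mℂ.∙ Mℂ.I) i j)) 0ᴿ (proj₂ (HH✶≈nI i j)) (scalar-im (fromℕ n) i j)))
        where
        z imag : ℝ
        z    = im ((H Mℂ.⊗ H ✶) i j)
        imag = c *ᴿ s *ᴿ (B Mℝ.⊗ A ᵀ) i j +ᴿ -ᴿ (c *ᴿ s) *ᴿ (A Mℝ.⊗ B ᵀ) i j
      gram : GramEquation
      gram i j = real-part⇒ ((A Mℝ.⊗ A ᵀ) i j) ((B Mℝ.⊗ B ᵀ) i j)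
        (fromℕ n) (fromℕ (suc m * n)) (Mℝ.I i j) (fromℕ-* (suc m) n)
        (≈ᴿ-trans real z nI (≈ᴿ-sym z real (gram-re i j))
          (≈ᴿ-trans z (re ((fromℝ (fromℕ n) Mℂ.∙ Mℂ.I) i j)) nI (proj₁ (HH✶≈nI i j)) (scalar-re (fromℕ n) i j)))
        where
        z real nI : ℝ
        z    = re ((H Mℂ.⊗ H ✶) i j)
        real = c *ᴿ c *ᴿ (A Mℝ.⊗ A ᵀ) i j +ᴿ s *ᴿ s *ᴿ (B Mℝ.⊗ B ᵀ) i j
        nI   = fromℕ n *ᴿ Mℝ.I i j

    isQUH⇐ : IsSignMatrix A → IsSignMatrix B → Amicable A B → GramEquation → IsQUH n m H
    isQUH⇐ ±A ±B amicable gram = (unit , λ i j → real i j , imaginary i j) ,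
      -- The entries of `A` and `B` are themselves the signs ε and δ.
      λ i j → A i j , B i j , ±A i j , ±B i j , entry-comm c s (A i j) (B i j)
      where
      unit : ∀ i j → modulus (H i j) ≈ᴿ 1ᴿ
      unit i j = modulus≈1 (H i j) (unit-modulus (re (H i j)) (im (H i j)) (A i j) (B i j)
        (entry-re c s (A i j) (B i j)) (entry-im c s (A i j) (B i j))
        (sign-square (A i j) (±A i j)) (sign-square (B i j) (±B i j)))
      real : ∀ i j → re ((H Mℂ.⊗ H ✶) i j) ≈ᴿ re ((fromℝ (fromℕ n) Mℂ.∙ Mℂ.I) i j)
      real i j = ≈ᴿ-trans z p nI (gram-re i j) (≈ᴿ-trans p (fromℕ n *ᴿ Mℝ.I i j) nI
        (real-part⇐ ((A Mℝ.⊗ A ᵀ) i j) ((B Mℝ.⊗ B ᵀ) i j)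
          (fromℕ n) (fromℕ (suc m * n)) (Mℝ.I i j) (fromℕ-* (suc m) n) (gram i j))
        (≈ᴿ-sym nI (fromℕ n *ᴿ Mℝ.I i j) (scalar-re (fromℕ n) i j)))
        where
        z p nI : ℝ
        z  = re ((H Mℂ.⊗ H ✶) i j)
        p  = c *ᴿ c *ᴿ (A Mℝ.⊗ A ᵀ) i j +ᴿ s *ᴿ s *ᴿ (B Mℝ.⊗ B ᵀ) i j
        nI = re ((fromℝ (fromℕ n) Mℂ.∙ Mℂ.I) i j)
      imaginary : ∀ i j → im ((H Mℂ.⊗ H ✶) i j) ≈ᴿ im ((fromℝ (fromℕ n) Mℂ.∙ Mℂ.I) i j)
      imaginary i j = ≈ᴿ-trans z p nI (gram-im i j) (≈ᴿ-trans p 0ᴿ nI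
        (imaginary-part⇐ ((A Mℝ.⊗ B ᵀ) i j) ((B Mℝ.⊗ A ᵀ) i j) (amicable i j))
        (≈ᴿ-sym nI 0ᴿ (scalar-im (fromℕ n) i j)))
        where
        z p nI : ℝ
        z  = im ((H Mℂ.⊗ H ✶) i j)
        p  = c *ᴿ s *ᴿ (B Mℝ.⊗ A ᵀ) i j +ᴿ -ᴿ (c *ᴿ s) *ᴿ (A Mℝ.⊗ B ᵀ) i j
        nI = im ((fromℝ (fromℕ n) Mℂ.∙ Mℂ.I) i j)

  -- Recovering the sign matrices from H.

  -- The entry condition carries its signs as witnesses, so projecting them out defines both
  -- matrices without any choice principle.
  isQUH⇒combine : (H : Matrix ℂ n) → IsQUH n m H →
                  ∃[ A ] ∃[ B ] (IsSignMatrix A × IsSignMatrix B × H Mℂ.≈ combine m A B)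
  isQUH⇒combine H (_ , entries) =
    A , B , (λ i j → proj₁ (proj₂ (proj₂ (entries i j)))) ,
    (λ i j → proj₁ (proj₂ (proj₂ (proj₂ (entries i j))))) ,
    λ i j → let z = fromℝ (A i j) *ᶜ fromℝ c +ᶜ fromℝ (B i j) *ᶜ (𝕚 *ᶜ fromℝ s) in
      ≈ᶜ-trans (H i j) z (combine m A B i j)
        (proj₂ (proj₂ (proj₂ (proj₂ (entries i j)))))
        (≈ᶜ-sym (combine m A B i j) z (entry-comm c s (A i j) (B i j)))
    where
    A B : Matrix ℝ n
    A i j = proj₁ (entries i j)
    B i j = proj₁ (proj₂ (entries i j))

theorem2p6 : (n m : ℕ) .{{_ : NonZero n}} .{{_ : NonZero m}} →
    ((A B : Matrix ℝ n) → IsSignMatrix A → IsSignMatrix B →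
    IsQUH n m (combine m A B) ⇔
    (Amicable A B ×
    (A Mℝ.⊗ A ᵀ) Mℝ.⊕ (fromℕ m Mℝ.∙ (B Mℝ.⊗ B ᵀ)) Mℝ.≈ (fromℕ (suc m * n) Mℝ.∙ Mℝ.I)))
    ×
    ((H : Matrix ℂ n) → IsQUH n m H →
    ∃[ A ] ∃[ B ] (IsSignMatrix A × IsSignMatrix B × H Mℂ.≈ combine m A B))
-- The instance `NonZero m` rules out m = 0, leaving only the successor case.
theorem2p6 n (suc k) =
  (λ A B ±A ±B → mk⇔ (isQUH⇒ n k A B) λ (amicable , gram) → isQUH⇐ n k A B ±A ±B amicable gram) ,
  isQUH⇒combine n k
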